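{- Fix an integer $r \ge 3$ and positive integers $s_1, \ldots, s_{r-1}, t$. Then, as $n \to \infty$, $$z_r(n, K(s_1, \ldots, s_{r-1}, t)) > n^{1-o(1)} \cdot z_{r-1}(n, K(s_1, \ldots, s_{r-3}, s_{r-2}s_{r-1}, t)).$$
   Context: A $k$-graph is a $k$-uniform hypergraph. For positive integers $a_1,\ldots,a_k$, $K(a_1,\ldots,a_k)$ denotes the complete $k$-partite $k$-graph with parts of size $a_1,\ldots,a_k$: its vertex set is a disjoint union of sets $S_1,\ldots,S_k$ with $|S_i|=a_i$, and its edges are all sets $\{x_1,\ldots,x_k\}$ with $(x_1,\ldots,x_k)\in S_1\times\cdots\times S_k$. The Zarankiewicz number $z_k(n,K(a_1,\ldots,a_k))$ is the maximum number of edges in a $k$-partite $k$-graph $H$ with parts $X_1,\ldots,X_k$, each of size $n$, such that there is no copy of $K(a_1,\ldots,a_k)$ in $H$ with $S_i\subset X_i$ for all $1\le i\le k$ (copies of $K(a_1,\ldots,a_k)$ in $H$ with $S_i\not\subset X_i$ for some $i$ are allowed). When $r=3$, the hypergraph on the right-hand side is the complete bipartite graph $K(s_1s_2,t)$. The term $o(1)$ denotes a quantity tending to $0$ as $n\to\infty$ with $r, s_1,\ldots,s_{r-1},t$ fixed.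
   Formalization: The strict inequality is stated only when at least one of s_1, …, s_{r-1}, t exceeds 1; if all equal 1, both Zarankiewicz numbers are 0 and the strict inequality fails, so only ≥ is stated in that case. -}

module Defs where

open import Data.Bool.Base using (if_then_else_)
open import Data.Fin.Base using (Fin; zero; suc; finToFun; funToFin)
open import Data.Fin.Properties using (all?; finToFun-funToFin)
open import Data.Fin.Subset using (Subset; _∈_; ∣_∣; ⊥; Nonempty; inside; outside)
open import Data.Fin.Subset.Properties using (_∈?_; anySubset?; ∉⊥; ∣p∣≤n)
open import Data.Nat using (ℕ; zero; suc; _*_; _^_; _≤_; _<_; z≤n; s≤s; _≟_)
open import Data.Nat.Properties using (m≤n⇒m<n∨m≡n)
open import Data.Product using (∃; _×_; _,_; proj₁; proj₂)
open import Data.Sum using (inj₁; inj₂)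
open import Data.Vec.Base using (Vec; []; _∷_; lookup; here; there)
open import Data.Vec.Relation.Unary.All using (All; []; _∷_)
open import Data.Vec.Relation.Unary.All.Properties using (lookup⁺)
open import Relation.Binary.PropositionalEquality using (_≡_; refl; sym; subst)
open import Relation.Nullary using (¬_; Dec; yes; no; does; contradiction)
open import Relation.Nullary.Decidable using (map′; _×-dec_; _→-dec_; ¬?)
open import Relation.Unary using (Decidable)

-- A k-partite k-graph with parts X₁, …, X_k, each a copy of Fin n, given by its
-- edge set.  An edge takes exactly one vertex from each part, so the possible
-- edges are the functions Fin k → Fin n; these are coded by Fin (n ^ k) through
-- the bijection finToFun / funToFin.
PartiteGraph : ℕ → ℕ → Set
PartiteGraph k n = Subset (n ^ k)

-- A copy of K(a₁, …, a_k) in H with vertex classes Sᵢ ⊆ Xᵢ.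
record Copy {k n} (a : Vec ℕ k) (H : PartiteGraph k n) : Set where
  constructor copy
  field
    S        : Vec (Subset n) k
    sizes    : ∀ i → ∣ lookup S i ∣ ≡ lookup a i
    complete : ∀ (e : Fin (n ^ k)) →
               (∀ i → finToFun {n} {k} e i ∈ lookup S i) → e ∈ H

Free : ∀ {k n} → Vec ℕ k → PartiteGraph k n → Set
Free a H = ¬ Copy a H

anyVecOfSubsets? : ∀ {n} k {P : Vec (Subset n) k → Set} → Decidable P → Dec (∃ P)
anyVecOfSubsets? zero P? =
  map′ (λ p → [] , p) (λ { ([] , p) → p }) (P? [])
anyVecOfSubsets? (suc k) P? =
  map′ (λ { (S , Ss , p) → (S ∷ Ss) , p }) (λ { (S ∷ Ss , p) → S , Ss , p })
       (anySubset? (λ S → anyVecOfSubsets? k (λ Ss → P? (S ∷ Ss))))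

copy? : ∀ {k n} (a : Vec ℕ k) (H : PartiteGraph k n) → Dec (Copy a H)
copy? {k} {n} a H =
  map′ (λ { (S , s , c) → copy S s c }) (λ { (copy S s c) → S , s , c })
    (anyVecOfSubsets? k λ S →
      all? (λ i → ∣ lookup S i ∣ ≟ lookup a i) ×-dec
      all? (λ e → all? (λ i → finToFun {n} {k} e i ∈? lookup S i) →-dec (e ∈? H)))

FreeOfSize : ∀ {k} n → Vec ℕ k → ℕ → Set
FreeOfSize {k} n a m = ∃ λ (H : PartiteGraph k n) → Free a H × ∣ H ∣ ≡ m

freeOfSize? : ∀ {k} n (a : Vec ℕ k) → Decidable (FreeOfSize n a)
freeOfSize? n a m = anySubset? (λ H → ¬? (copy? a H) ×-dec (∣ H ∣ ≟ m))

-- The greatest m ≤ b satisfying P (0 if there is none).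
greatest : ∀ {P : ℕ → Set} → Decidable P → ℕ → ℕ
greatest P? zero    = 0
greatest P? (suc b) = if does (P? (suc b)) then suc b else greatest P? b

-- The Zarankiewicz number z_k(n, K(a₁, …, a_k)); n ^ k bounds the number of
-- edges.  See z-isMaximum below.
z : ∀ k → ℕ → Vec ℕ k → ℕ
z k n a = greatest (freeOfSize? n a) (n ^ k)

record IsMaximum (P : ℕ → Set) (m : ℕ) : Set where
  field
    attained   : P m
    upperBound : ∀ {j} → P j → j ≤ m

greatest-isMaximum : ∀ {P : ℕ → Set} (P? : Decidable P) b →
                     (∀ {j} → P j → j ≤ b) → ∃ P → IsMaximum P (greatest P? b)
greatest-isMaximum {P} P? zero bound (j , p) with bound p
... | z≤n = record { attained = p ; upperBound = bound }
greatest-isMaximum {P} P? (suc b) bound ∃P with P? (suc b)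
... | yes p = record { attained = p ; upperBound = bound }
... | no ¬p = greatest-isMaximum P? b bound′ ∃P
  where
  bound′ : ∀ {j} → P j → j ≤ b
  bound′ q with m≤n⇒m<n∨m≡n (bound q)
  ... | inj₁ (s≤s j≤b) = j≤b
  ... | inj₂ refl      = contradiction q ¬p

positiveSize⇒nonempty : ∀ {n} (p : Subset n) → 0 < ∣ p ∣ → Nonempty p
positiveSize⇒nonempty (inside  ∷ p) _   = zero , here
positiveSize⇒nonempty (outside ∷ p) 0<p with positiveSize⇒nonempty p 0<p
... | i , i∈p = suc i , there i∈p

empty-free : ∀ {k n} (a : Vec ℕ k) → All (0 <_) a → Free {k} {n} a ⊥
empty-free {k} {n} a 0<a (copy S sizes complete) =
  ∉⊥ (complete (funToFin (λ i → proj₁ (point i))) λ i →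
    subst (_∈ lookup S i)
          (sym (finToFun-funToFin {k} {n} (λ i → proj₁ (point i)) i))
          (proj₂ (point i)))
  where
  point : ∀ i → Nonempty (lookup S i)
  point i = positiveSize⇒nonempty (lookup S i)
    (subst (0 <_) (sym (sizes i)) (lookup⁺ 0<a i))

z-isMaximum : ∀ k n (a : Vec ℕ k) → All (0 <_) a →
              IsMaximum (FreeOfSize n a) (z k n a)
z-isMaximum k n a 0<a =
  greatest-isMaximum (freeOfSize? n a) (n ^ k)
    (λ { (H , _ , refl) → ∣p∣≤n H })
    (_ , ⊥ , empty-free a 0<a , refl)

-- Comparison of sequences up to a factor n^(1-o(1)), unfolded as: for every
-- rational ε = p/q > 0 and all sufficiently large n, the comparison holds
-- with the factor n^(1-ε).  Raising to the q-th power and multiplying by n^p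
-- clears the roots:
--   f n > n^(1-p/q) · g n   iff   n^p · (f n)^q > n^q · (g n)^q   (n ≥ 1).

infix 4 _>n^[1-o1]·_ _≥n^[1-o1]·_

_>n^[1-o1]·_ : (ℕ → ℕ) → (ℕ → ℕ) → Set
f >n^[1-o1]· g = ∀ p q → 0 < p → 0 < q →
  ∃ λ N → ∀ n → N ≤ n → n ^ q * g n ^ q < n ^ p * f n ^ q

_≥n^[1-o1]·_ : (ℕ → ℕ) → (ℕ → ℕ) → Set
f ≥n^[1-o1]· g = ∀ p q → 0 < p → 0 < q →
  ∃ λ N → ∀ n → N ≤ n → n ^ q * g n ^ q ≤ n ^ p * f n ^ q

module Submission where

-- A set A of numbers below n / 2 without three-term progressions gives, for each
-- colour c modulo n, an induced matching {(c + 2a, c + a) : a ∈ A} (Ruzsa and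
-- Szemerédi).  Given a graph G free of K(…, bc, t), replace each of its edges
-- (…, c, w) by the |A| edges (…, x, y, w) with x y an edge of colour c.  A copy of
-- K(…, b, c, t) in the result contains a complete b × c bipartite graph in its
-- two middle classes; its edges have different colours since the matchings are
-- induced, so these colours span a K(…, bc, t) in G.  Hence
-- |A| · z_{r-1} ≤ z_r, and a set with |A| = n^(1-o(1)) is given by Behrend's
-- argument, without the pigeonhole step: the vectors v in [0, d)^D are written in
-- base 2d with |v|² prepended as leading part, and no point of a paraboloid is
-- the midpoint of two others.

open import Defs
open import Data.Nat using (ℕ; zero; suc; _+_; _*_; _^_; _≤_; _<_; z≤n; s≤s; NonZero; nonZero; >-nonZero; >-nonZero⁻¹; _<?_)
open import Data.Nat.Properties hiding (suc-injective)
open import Algebra.Properties.CommutativeSemigroup +-commutativeSemigroup using () renaming (interchange to +-interchange; xy∙z≈xz∙y to +-swapʳ)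
open import Algebra.Properties.CommutativeSemigroup *-commutativeSemigroup using () renaming (interchange to *-interchange)
open import Data.Nat.DivMod using (_%_; _/_; _mod_; m≡m%n+[m/n]*n; [m+kn]%n≡m%n; m<n⇒m%n≡m; m%n<n)
open import Data.Nat.Tactic.RingSolver using (solve-∀)
open import Data.Fin as Fin using (Fin; zero; suc; toℕ; combine; remQuot; finToFun; funToFin)
open import Data.Fin.Properties using (toℕ-injective; toℕ<n; toℕ-fromℕ<; suc-injective; finToFun-funToFin; funToFin-finToFin; combine-remQuot)
open import Data.Fin.Subset using (Subset; inside; outside; _∈_; _∉_; ∣_∣; ⊥; ⁅_⁆)
open import Data.Fin.Subset.Properties using (∉⊥; ∣⊥∣≡0; ∣⁅x⁆∣≡1; x∈⁅y⁆⇒x≡y)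
open import Data.Product using (∃; ∃₂; _×_; _,_; proj₁; proj₂; uncurry)
open import Data.Sum using (_⊎_; inj₁; inj₂)
open import Data.Vec as Vec using (Vec; []; _∷_; _∷ʳ_; lookup; tabulate; _[_]≔_; here; there)
open import Data.Vec.Properties using (lookup∘tabulate; tabulate∘lookup; tabulate-cong)
open import Data.Vec.Relation.Unary.All using (All; []; _∷_)
open import Data.Vec.Relation.Unary.Any using (Any; here; there)
open import Data.Vec.Relation.Binary.Pointwise.Inductive using (Pointwise; []; _∷_)
open import Data.Vec.Relation.Binary.Pointwise.Extensional using (ext; extensional⇒inductive)
import Data.Vec.Relation.Binary.Pointwise.Inductive as Pointwise
open import Function using (_∘_; _$_; it)
open import Function.Definitions using (Injective)
open import Relation.Binary.PropositionalEquality
open import Relation.Nullary using (yes; no; contradiction)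

-- Enumerating subsets and forming images

nth : ∀ {n} (p : Subset n) → Fin ∣ p ∣ → Fin n
nth (inside  ∷ p) zero    = zero
nth (inside  ∷ p) (suc i) = suc (nth p i)
nth (outside ∷ p) i       = suc (nth p i)

nth-∈ : ∀ {n} (p : Subset n) i → nth p i ∈ p
nth-∈ (inside  ∷ p) zero    = here
nth-∈ (inside  ∷ p) (suc i) = there (nth-∈ p i)
nth-∈ (outside ∷ p) i       = there (nth-∈ p i)

nth-injective : ∀ {n} (p : Subset n) → Injective _≡_ _≡_ (nth p)
nth-injective (inside  ∷ p) {zero}  {zero}  _  = refl
nth-injective (inside  ∷ p) {suc i} {suc j} eq =
  cong suc (nth-injective p (suc-injective eq))
nth-injective (outside ∷ p) eq = nth-injective p (suc-injective eq)

∣insert∣ : ∀ {n} (p : Subset n) {x} → x ∉ p → ∣ p [ x ]≔ inside ∣ ≡ suc ∣ p ∣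
∣insert∣ (inside  ∷ p) {zero}  x∉p = contradiction here x∉p
∣insert∣ (outside ∷ p) {zero}  x∉p = refl
∣insert∣ (inside  ∷ p) {suc x} x∉p = cong suc (∣insert∣ p (x∉p ∘ there))
∣insert∣ (outside ∷ p) {suc x} x∉p = ∣insert∣ p (x∉p ∘ there)

∈-insert⁻ : ∀ {n} (p : Subset n) x {y} → y ∈ p [ x ]≔ inside → y ≡ x ⊎ y ∈ p
∈-insert⁻ (_ ∷ p) zero    here        = inj₁ refl
∈-insert⁻ (_ ∷ p) zero    (there y∈p) = inj₂ (there y∈p)
∈-insert⁻ (_ ∷ p) (suc x) here        = inj₂ here
∈-insert⁻ (_ ∷ p) (suc x) (there y∈)  with ∈-insert⁻ p x y∈
... | inj₁ y≡x = inj₁ (cong suc y≡x)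
... | inj₂ y∈p = inj₂ (there y∈p)

image : ∀ {k n} → (Fin k → Fin n) → Subset n
image {zero}  f = ⊥
image {suc k} f = image (f ∘ suc) [ f zero ]≔ inside

∈-image⁻ : ∀ {k n} (f : Fin k → Fin n) {x} → x ∈ image f → ∃ λ i → f i ≡ x
∈-image⁻ {zero}  f x∈ = contradiction x∈ ∉⊥
∈-image⁻ {suc k} f x∈ with ∈-insert⁻ (image (f ∘ suc)) (f zero) x∈
... | inj₁ x≡f0 = zero , sym x≡f0
... | inj₂ x∈′ with ∈-image⁻ (f ∘ suc) x∈′
...   | i , fi≡x = suc i , fi≡x

∣image∣ : ∀ {k n} (f : Fin k → Fin n) → Injective _≡_ _≡_ f → ∣ image f ∣ ≡ k
∣image∣ {zero}  {n} f inj = ∣⊥∣≡0 n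
∣image∣ {suc k} f inj =
  trans (∣insert∣ (image (f ∘ suc)) f0∉) (cong suc (∣image∣ (f ∘ suc) (suc-injective ∘ inj)))
  where
  f0∉ : f zero ∉ image (f ∘ suc)
  f0∉ f0∈ with ∈-image⁻ (f ∘ suc) f0∈
  ... | i , fi≡f0 with inj fi≡f0
  ...   | ()

remQuot-injective : ∀ {k} m → Injective _≡_ _≡_ (remQuot {k} m)
remQuot-injective {k} m {i} {j} eq =
  trans (sym (combine-remQuot {k} m i))
    (trans (cong (uncurry combine) eq) (combine-remQuot {k} m j))

-- Edges as vectors of vertices

encode : ∀ {k n} → Vec (Fin n) k → Fin (n ^ k)
encode v = funToFin (lookup v)

decode : ∀ {k n} → Fin (n ^ k) → Vec (Fin n) k
decode {k} {n} e = tabulate (finToFun {n} {k} e)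

decode-encode : ∀ {k n} (v : Vec (Fin n) k) → decode (encode v) ≡ v
decode-encode v = trans (tabulate-cong (finToFun-funToFin (lookup v))) (tabulate∘lookup v)

funToFin-cong : ∀ {k n} {f g : Fin k → Fin n} → f ≗ g → funToFin f ≡ funToFin g
funToFin-cong {zero}  f≗g = refl
funToFin-cong {suc k} f≗g = cong₂ combine (f≗g zero) (funToFin-cong (f≗g ∘ suc))

encode-decode : ∀ {k n} (e : Fin (n ^ k)) → encode (decode {k} {n} e) ≡ e
encode-decode {k} {n} e =
  trans (funToFin-cong (lookup∘tabulate (finToFun {n} {k} e))) (funToFin-finToFin {k} {n} e)

encode-injective : ∀ {k n} {v w : Vec (Fin n) k} → encode v ≡ encode w → v ≡ w
encode-injective {v = v} {w} eq =
  trans (sym (decode-encode v)) (trans (cong decode eq) (decode-encode w))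

decode-injective : ∀ {k n} {d e : Fin (n ^ k)} → decode {k} {n} d ≡ decode e → d ≡ e
decode-injective {k} {n} {d} {e} eq =
  trans (sym (encode-decode {k} {n} d)) (trans (cong encode eq) (encode-decode {k} {n} e))

-- Copies as boxes of vectors

HasSize : ∀ {n} → Subset n → ℕ → Set
HasSize p a = ∣ p ∣ ≡ a

-- An inductive form of `Copy`: `Pointwise` lets classes be split off one at a time, and `P` may be
-- any predicate on vectors, which the induction in `contract` exploits.
record Box {k n} (a : Vec ℕ k) (P : Vec (Fin n) k → Set) : Set where
  constructor box
  field
    sides : Vec (Subset n) k
    sizes : Pointwise HasSize sides a
    full  : ∀ {v} → Pointwise _∈_ v sides → P v

copy⇒box : ∀ {k n} {a : Vec ℕ k} {H : PartiteGraph k n} →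
           Copy a H → Box a (λ v → encode v ∈ H)
copy⇒box (copy S sizes complete) = box S (extensional⇒inductive (ext sizes)) λ {v} v∈S →
  complete (encode v) λ i →
    subst (_∈ lookup S i) (sym (finToFun-funToFin (lookup v) i)) (Pointwise.lookup v∈S i)

box⇒copy : ∀ {k n} {a : Vec ℕ k} {H : PartiteGraph k n} →
           Box a (λ v → encode v ∈ H) → Copy a H
box⇒copy {k} {n} {a} {H} (box S sizes full) = copy S (Pointwise.lookup sizes) λ e e∈S →
  subst (_∈ H) (encode-decode {k} {n} e) $ full {decode e} $ extensional⇒inductive $ ext λ i →
    subst (_∈ lookup S i) (sym (lookup∘tabulate (finToFun {n} {k} e) i)) (e∈S i)

point : ∀ {n a} (p : Subset n) → HasSize p a → 0 < a → ∃ (_∈ p)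
point p refl 0<a = positiveSize⇒nonempty p 0<a

points : ∀ {k n} {S : Vec (Subset n) k} {a : Vec ℕ k} →
         Pointwise HasSize S a → All (0 <_) a → ∃ λ (v : Vec (Fin n) k) → Pointwise _∈_ v S
points []                 []         = [] , []
points (_∷_ {x = p} h hs) (0<a ∷ pos) with point p h 0<a | points hs pos
... | x , x∈p | v , v∈S = x ∷ v , x∈p ∷ v∈S

-- Blowing up edges to induced matchings

-- The edges between the left and the right class form n matchings of size K,
-- indexed by the colours c : Fin n.  With i ≡ i′ and with c, c′ equal the
-- field says that each of them is a matching and induced.
record InducedMatchings (K n : ℕ) : Set where
  field
    left right : Fin K → Fin n → Fin n
    induced    : ∀ {i i′ j c c′} → left i c ≡ left j c′ → right i′ c ≡ right j c′ →
                 i ≡ i′ × i ≡ j × c ≡ c′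

module Blowup {K n} (M : InducedMatchings K n) where
  open InducedMatchings M

  blowup : ∀ m → Fin K → Vec (Fin n) (2 + m) → Vec (Fin n) (3 + m)
  blowup zero    i (c ∷ w ∷ []) = left i c ∷ right i c ∷ w ∷ []
  blowup (suc m) i (x ∷ v)      = x ∷ blowup m i v

  -- By `induced`, the two ends of a matching edge determine its index and its colour.
  blowup-injective : ∀ m {i j} u v → blowup m i u ≡ blowup m j v → i ≡ j × u ≡ v
  blowup-injective zero (c ∷ w ∷ []) (c′ ∷ w′ ∷ []) eq
    with induced (cong (λ v → lookup v zero) eq) (cong (λ v → lookup v (suc zero)) eq)
       | cong (λ v → lookup v (suc (suc zero))) eq
  ... | _ , i≡j , refl | refl = i≡j , refl
  blowup-injective (suc m) (x ∷ u) (y ∷ v) eq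
    with cong (λ v → lookup v zero) eq | blowup-injective m u v (cong Vec.tail eq)
  ... | refl | i≡j , refl = i≡j , refl

  Blowup : ∀ m → (Vec (Fin n) (2 + m) → Set) → Vec (Fin n) (3 + m) → Set
  Blowup m P v = ∃₂ λ i u → P u × blowup m i u ≡ v

  -- All pairs from `B` and `C` are matching edges, and their colours form the class of size
  -- `b * c`; `0 < t` supplies a vertex of `D` with which to define these colours.
  contract₀ : ∀ {b c t} {P : Vec (Fin n) 2 → Set} → 0 < t →
              Box (b ∷ c ∷ t ∷ []) (Blowup 0 P) → Box (b * c ∷ t ∷ []) P
  contract₀ {P = P} 0<t (box (B ∷ C ∷ D ∷ []) (refl ∷ refl ∷ h ∷ []) full) =
    box (image colour ∷ D ∷ []) (∣image∣ colour colour-injective ∷ h ∷ []) full′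
    where
    Edge : Fin n → Fin n → (Fin n → Set) → Set
    Edge x y Q = ∃₂ λ i c → left i c ≡ x × right i c ≡ y × Q c

    edge : ∀ {x y w} → x ∈ B → y ∈ C → w ∈ D → Edge x y λ c → P (c ∷ w ∷ [])
    edge x∈B y∈C w∈D with full (x∈B ∷ y∈C ∷ w∈D ∷ [])
    ... | i , (c ∷ _ ∷ []) , p , refl = i , c , refl , refl , p

    pair : Fin (∣ B ∣ * ∣ C ∣) → Fin ∣ B ∣ × Fin ∣ C ∣
    pair = remQuot {∣ B ∣} ∣ C ∣

    edge₀ : ∀ i j → Edge (nth B i) (nth C j) λ c → P (c ∷ proj₁ (point D h 0<t) ∷ [])
    edge₀ i j = edge (nth-∈ B i) (nth-∈ C j) (proj₂ (point D h 0<t))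

    colour : Fin (∣ B ∣ * ∣ C ∣) → Fin n
    colour k = let (i , j) = pair k ; (_ , c , _) = edge₀ i j in c

    -- Edges x y and x′ y′ of the same colour coincide, because x y′ is an edge too.
    colour-injective : Injective _≡_ _≡_ colour
    colour-injective {k} {k′} eq =
      let (i  , j)  = pair k
          (i′ , j′) = pair k′
          (e  , c  , l  , r  , _) = edge₀ i j
          (e′ , c′ , l′ , r′ , _) = edge₀ i′ j′
          (_  , _  , l″ , r″ , _) = edge₀ i j′
          (e≡e′ , _) = induced (trans l (sym l″)) (trans (cong (right e′) eq) (trans r′ (sym r″)))
      in remQuot-injective {∣ B ∣} ∣ C ∣ $ cong₂ _,_
           (nth-injective B (trans (sym l) (trans (cong₂ left e≡e′ eq) l′)))
           (nth-injective C (trans (sym r) (trans (cong₂ right e≡e′ eq) r′)))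

    full′ : ∀ {v} → Pointwise _∈_ v (image colour ∷ D ∷ []) → P v
    full′ {c ∷ w ∷ []} (c∈ ∷ w∈D ∷ []) =
      let (k , eq) = ∈-image⁻ colour c∈
          (i , j)  = pair k
          (_ , _ , l  , r  , _) = edge₀ i j
          -- The edge found with `w` may come from another witness than `edge₀`; having the same
          -- ends, it has the same colour.
          (_ , _ , l′ , r′ , p) = edge (nth-∈ B i) (nth-∈ C j) w∈D
          (_ , _ , c≡c′) = induced (trans l (sym l′)) (trans r (sym r′))
      in subst (λ c → P (c ∷ w ∷ [])) (trans (sym c≡c′) eq) p

  -- Induction on `s`. The first class `A` is absorbed into the predicate, which then demands
  -- `P (x ∷ v)` for all `x` in `A` at once.
  contract : ∀ {m} (s : Vec ℕ m) {b c t} {P : Vec (Fin n) (2 + m) → Set} →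
             All (0 <_) (s ∷ʳ b ∷ʳ c ∷ʳ t) →
             Box (s ∷ʳ b ∷ʳ c ∷ʳ t) (Blowup m P) → Box (s ∷ʳ b * c ∷ʳ t) P
  contract [] (_ ∷ _ ∷ 0<t ∷ []) X = contract₀ 0<t X
  contract {suc m} (a ∷ s) {P = P} (0<a ∷ pos) (box (A ∷ S) (h ∷ hs) full)
    with contract s {P = λ v → ∀ {x} → x ∈ A → P (x ∷ v)} pos (box S hs full′)
    where
    -- The preimage of v under blowup does not depend on the vertex x of A.
    full′ : ∀ {v} → Pointwise _∈_ v S → Blowup m (λ u → ∀ {x} → x ∈ A → P (x ∷ u)) v
    full′ v∈S with point A h 0<a
    ... | x₀ , x₀∈A with full (x₀∈A ∷ v∈S)
    ...   | i , (_ ∷ u) , _ , refl = i , u , p , refl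
      where
      p : ∀ {x} → x ∈ A → P (x ∷ u)
      p x∈A with full (x∈A ∷ v∈S)
      ... | j , (_ ∷ u′) , q , eq
        with cong (λ v → lookup v zero) eq | blowup-injective m u′ u (cong Vec.tail eq)
      ...   | refl | _ , refl = q
  ... | box S′ hs′ full″ = box (A ∷ S′) (h ∷ hs′) λ { {_ ∷ _} (x∈A ∷ v∈S′) → full″ v∈S′ x∈A }

  blowupGraph : ∀ m → PartiteGraph (2 + m) n → PartiteGraph (3 + m) n
  blowupGraph m G = image λ k → let (i , e) = remQuot {K} ∣ G ∣ k in
                    encode (blowup m i (decode (nth G e)))

  ∣blowupGraph∣ : ∀ m (G : PartiteGraph (2 + m) n) → ∣ blowupGraph m G ∣ ≡ K * ∣ G ∣
  ∣blowupGraph∣ m G = ∣image∣ _ λ {k} {k′} eq →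
    let (i≡j , eq′) = blowup-injective m _ _ (encode-injective eq)
        e≡e′ = nth-injective G (decode-injective {2 + m} {n} eq′)
    in remQuot-injective {K} ∣ G ∣ (cong₂ _,_ i≡j e≡e′)

  blowupGraph-free : ∀ {m} (s : Vec ℕ m) {b c t} → All (0 <_) (s ∷ʳ b ∷ʳ c ∷ʳ t) →
                     ∀ G → Free (s ∷ʳ b * c ∷ʳ t) G →
                     Free (s ∷ʳ b ∷ʳ c ∷ʳ t) (blowupGraph m G)
  blowupGraph-free {m} s pos G free X with copy⇒box X
  ... | box S hs full = free (box⇒copy (contract s pos (box S hs (preimage ∘ full))))
    where
    preimage : ∀ {v} → encode v ∈ blowupGraph m G → Blowup m (λ u → encode u ∈ G) v
    preimage v∈ with ∈-image⁻ _ v∈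
    ... | k , eq = let (i , e) = remQuot {K} ∣ G ∣ k in
      i , decode (nth G e) ,
      subst (_∈ G) (sym (encode-decode {2 + m} {n} (nth G e))) (nth-∈ G e) ,
      encode-injective eq

-- Zarankiewicz numbers: comparison and positivity

All-contract : ∀ {m} (s : Vec ℕ m) {b c t} → All (0 <_) (s ∷ʳ b ∷ʳ c ∷ʳ t) →
               All (0 <_) (s ∷ʳ b * c ∷ʳ t)
All-contract []      (0<b ∷ 0<c ∷ 0<t ∷ []) = *-mono-≤ 0<b 0<c ∷ 0<t ∷ []
All-contract (_ ∷ s) (0<a ∷ pos)            = 0<a ∷ All-contract s pos

Any-contract : ∀ {m} (s : Vec ℕ m) {b c t} → All (0 <_) (s ∷ʳ b ∷ʳ c ∷ʳ t) →
               Any (1 <_) (s ∷ʳ b ∷ʳ c ∷ʳ t) → Any (1 <_) (s ∷ʳ b * c ∷ʳ t)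
Any-contract []      (_ ∷ 0<c ∷ _)   (here 1<b)         = here (*-mono-≤ 1<b 0<c)
Any-contract []      (0<b ∷ _)       (there (here 1<c)) = here (*-mono-≤ 0<b 1<c)
Any-contract []      _               (there (there 1<t)) = there 1<t
Any-contract (_ ∷ s) _               (here 1<a)         = here 1<a
Any-contract (_ ∷ s) (_ ∷ pos)       (there 1<)         = there (Any-contract s pos 1<)

z-blowup : ∀ {K n m} → InducedMatchings K n → (s : Vec ℕ m) {b c t : ℕ} →
           All (0 <_) (s ∷ʳ b ∷ʳ c ∷ʳ t) →
           K * z (2 + m) n (s ∷ʳ b * c ∷ʳ t) ≤ z (3 + m) n (s ∷ʳ b ∷ʳ c ∷ʳ t)
z-blowup {K} {n} {m} M s {b} {c} {t} pos =
  let (G , free , eq) = IsMaximum.attained (z-isMaximum (2 + m) n (s ∷ʳ b * c ∷ʳ t) (All-contract s pos))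
  in IsMaximum.upperBound (z-isMaximum (3 + m) n (s ∷ʳ b ∷ʳ c ∷ʳ t) pos)
       (blowupGraph m G , blowupGraph-free s pos G free , trans (∣blowupGraph∣ m G) (cong (K *_) eq))
  where open Blowup M

avoid : ∀ {k n} (f : Fin k → Fin n) → Injective _≡_ _≡_ f → 1 < k → ∀ y → ∃ λ i → f i ≢ y
avoid {suc zero}    f inj (s≤s ()) y
avoid {suc (suc _)} f inj _        y with f zero Fin.≟ y
... | no  f0≢y = zero , f0≢y
... | yes f0≡y = suc zero , λ f1≡y → contradiction (inj (trans f0≡y (sym f1≡y))) λ ()

pointsAvoiding : ∀ {k n} {S : Vec (Subset n) k} {a : Vec ℕ k} →
                 Pointwise HasSize S a → All (0 <_) a → Any (1 <_) a →
                 ∀ (v : Vec (Fin n) k) → ∃ λ u → Pointwise _∈_ u S × u ≢ v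
pointsAvoiding (_∷_ {x = p} refl hs) (_ ∷ pos) (here 1<p) (y ∷ _)
  with avoid (nth p) (nth-injective p) 1<p y | points hs pos
... | i , ≢y | u , u∈S =
  nth p i ∷ u , nth-∈ p i ∷ u∈S , ≢y ∘ cong (λ v → lookup v zero)
pointsAvoiding (_∷_ {x = p} h hs) (0<a ∷ pos) (there 1<) (_ ∷ v)
  with point p h 0<a | pointsAvoiding hs pos 1< v
... | x , x∈p | u , u∈S , u≢v = x ∷ u , x∈p ∷ u∈S , u≢v ∘ cong Vec.tail

-- Once some class has two vertices, a copy contains an edge other than the given one.
singleton-free : ∀ {k n} {a : Vec ℕ k} → All (0 <_) a → Any (1 <_) a →
                 (v : Vec (Fin n) k) → Free a ⁅ encode v ⁆
singleton-free pos 1< v X with copy⇒box X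
... | box S hs full with pointsAvoiding hs pos 1< v
...   | u , u∈S , u≢v = u≢v (encode-injective (x∈⁅y⁆⇒x≡y _ (full u∈S)))

z-positive : ∀ {k n} .{{_ : NonZero n}} {a : Vec ℕ k} → All (0 <_) a → Any (1 <_) a → 0 < z k n a
z-positive {k} {suc n} pos 1< = IsMaximum.upperBound (z-isMaximum k (suc n) _ pos)
  (⁅ encode v ⁆ , singleton-free pos 1< v , ∣⁅x⁆∣≡1 (encode v))
  where v = Vec.replicate k zero

-- Matchings from progression-free sets

ProgressionFree : ∀ {K} → (Fin K → ℕ) → Set
ProgressionFree a = ∀ {i j k} → a i + a j ≡ a k + a k → i ≡ j × i ≡ k

-- Congruence without subtraction: to each number is added the multiple of `n` contained in the
-- other.
%-≡⇒ : ∀ n .{{_ : NonZero n}} x y → x % n ≡ y % n → ∃₂ λ p q → x + p * n ≡ y + q * n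
%-≡⇒ n x y eq = y / n , x / n , (begin
  x + y / n * n                   ≡⟨ cong (_+ y / n * n) (m≡m%n+[m/n]*n x n) ⟩
  x % n + x / n * n + y / n * n   ≡⟨ cong (λ r → r + x / n * n + y / n * n) eq ⟩
  y % n + x / n * n + y / n * n   ≡⟨ +-swapʳ (y % n) _ _ ⟩
  y % n + y / n * n + x / n * n   ≡⟨ cong (_+ x / n * n) (m≡m%n+[m/n]*n y n) ⟨
  y + x / n * n                   ∎)
  where open ≡-Reasoning

congruent⇒≡ : ∀ {n x y} p q → x < n → y < n → x + p * n ≡ y + q * n → x ≡ y
congruent⇒≡ {n@(suc _)} {x} {y} p q x<n y<n eq = begin
  x               ≡⟨ m<n⇒m%n≡m x<n ⟨
  x % n           ≡⟨ [m+kn]%n≡m%n x p n ⟨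
  (x + p * n) % n ≡⟨ cong (_% n) eq ⟩
  (y + q * n) % n ≡⟨ [m+kn]%n≡m%n y q n ⟩
  y % n           ≡⟨ m<n⇒m%n≡m y<n ⟩
  y               ∎
  where open ≡-Reasoning

mod-≡⇒ : ∀ n .{{_ : NonZero n}} x y → x mod n ≡ y mod n → ∃₂ λ p q → x + p * n ≡ y + q * n
mod-≡⇒ n x y eq = %-≡⇒ n x y
  (trans (sym (toℕ-fromℕ< (m%n<n x n))) (trans (cong toℕ eq) (toℕ-fromℕ< (m%n<n y n))))

-- Write x, y, w for `a i`, `a i′`, `a j`. Equal left ends give c + 2x ≡ c′ + 2w and equal right
-- ends c + y ≡ c′ + w modulo `n`, so w + y ≡ 2x. Both sides are below `n`, hence equal, and the
-- progression w, x, y must be constant.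
ruzsaSzemerédi : ∀ {K n} .{{_ : NonZero n}} (a : Fin K → ℕ) → ProgressionFree a →
                 (∀ i → a i + a i < n) → InducedMatchings K n
ruzsaSzemerédi {K} {n} a free 2a<n = record { left = left ; right = right ; induced = induced }
  where
  left right : Fin K → Fin n → Fin n
  left  i c = (toℕ c + (a i + a i)) mod n
  right i c = (toℕ c + a i) mod n

  +<n : ∀ i j → a i + a j < n
  +<n i j with ≤-total (a i) (a j)
  ... | inj₁ i≤j = ≤-<-trans (+-monoˡ-≤ (a j) i≤j) (2a<n j)
  ... | inj₂ j≤i = ≤-<-trans (+-monoʳ-≤ (a i) j≤i) (2a<n i)

  eliminate : ∀ c c′ x y w n p q p′ q′ →
    c + (x + x) + p * n ≡ c′ + (w + w) + q * n → c + y + p′ * n ≡ c′ + w + q′ * n →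
    w + y + (p′ + q) * n ≡ x + x + (p + q′) * n
  -- With `c + c′ + w` added on both sides, the claim is the sum of `r` and the reverse of `l`.
  eliminate c c′ x y w n p q p′ q′ l r = +-cancelˡ-≡ (c + c′ + w) _ _ (begin
    c + c′ + w + (w + y + (p′ + q) * n)               ≡⟨ i₁ c c′ y w n p′ q ⟩
    (c + y + p′ * n) + (c′ + (w + w) + q * n)         ≡⟨ cong₂ _+_ r (sym l) ⟩
    (c′ + w + q′ * n) + (c + (x + x) + p * n)         ≡⟨ i₂ c c′ x w n p q′ ⟩
    c + c′ + w + (x + x + (p + q′) * n)               ∎)
    where
    open ≡-Reasoning
    i₁ : ∀ c c′ y w n p′ q → c + c′ + w + (w + y + (p′ + q) * n) ≡
                             (c + y + p′ * n) + (c′ + (w + w) + q * n)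
    i₁ = solve-∀
    i₂ : ∀ c c′ x w n p q′ → (c′ + w + q′ * n) + (c + (x + x) + p * n) ≡
                             c + c′ + w + (x + x + (p + q′) * n)
    i₂ = solve-∀

  induced : ∀ {i i′ j c c′} → left i c ≡ left j c′ → right i′ c ≡ right j c′ →
            i ≡ i′ × i ≡ j × c ≡ c′
  induced {i} {i′} {j} {c} {c′} l r with mod-≡⇒ n _ _ l | mod-≡⇒ n _ _ r
  ... | p , q , eq | p′ , q′ , eq′
    with free (congruent⇒≡ (p′ + q) (p + q′) (+<n j i′) (2a<n i)
                (eliminate (toℕ c) (toℕ c′) (a i) (a i′) (a j) n p q p′ q′ eq eq′))
  ... | refl , refl = refl , refl , toℕ-injective
    (congruent⇒≡ p q (toℕ<n c) (toℕ<n c′) (+-cancelʳ-≡ (a i + a i) _ _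
      (trans (+-swapʳ (toℕ c) _ _) (trans eq (+-swapʳ (toℕ c′) _ _)))))

-- Behrend's construction on a paraboloid

-- The digits of v in base d + d, least significant first, with s + |v|² on top.
lift : ∀ {d D} → ℕ → Vec (Fin d) D → ℕ
lift         s []      = s
lift {d = d} s (x ∷ v) = toℕ x + lift (s + toℕ x * toℕ x) v * (d + d)

-- As `w` is the midpoint of `x` and `y`, `f` is taken to be half their distance; the equation is
-- the parallelogram law.
midpoint-squares : ∀ x y w → x + y ≡ w + w → ∃ λ f →
  x * x + y * y ≡ w * w + w * w + (f * f + f * f) × (f ≡ 0 → x ≡ y × x ≡ w)
midpoint-squares x y w eq with ≤-total y w
... | inj₁ y≤w with m≤n⇒∃[o]m+o≡n y≤w
...   | f , refl with +-cancelˡ-≡ y _ _ (trans (+-comm y x) (trans eq (i y f)))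
  where
  i : ∀ y f → y + f + (y + f) ≡ y + (y + f + f)
  i = solve-∀
...     | refl = f , i y f , λ { refl → trans (+-identityʳ _) (+-identityʳ _) , +-identityʳ _ }
  where
  i : ∀ y f → (y + f + f) * (y + f + f) + y * y ≡
              (y + f) * (y + f) + (y + f) * (y + f) + (f * f + f * f)
  i = solve-∀
midpoint-squares x y w eq | inj₂ w≤y with m≤n⇒∃[o]m+o≡n w≤y
...   | f , refl with +-cancelʳ-≡ w _ _ (trans (i x w f) eq)
  where
  i : ∀ x w f → x + f + w ≡ x + (w + f)
  i = solve-∀
...     | refl = f , i x f , λ { refl → sym (trans (+-identityʳ _) (+-identityʳ _)) , sym (+-identityʳ _) }
  where
  i : ∀ x f → x * x + (x + f + f) * (x + f + f) ≡
              (x + f) * (x + f) + (x + f) * (x + f) + (f * f + f * f)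
  i = solve-∀

digit : ∀ {B r r′} q q′ → r < B → r′ < B → r + q * B ≡ r′ + q′ * B → r ≡ r′ × q ≡ q′
digit {B@(suc _)} {r} q q′ r<B r′<B eq with congruent⇒≡ q q′ r<B r′<B eq
... | refl = refl , *-cancelʳ-≡ q q′ B (+-cancelˡ-≡ r _ _ eq)

f²+f²≡0⇒f≡0 : ∀ f → f * f + f * f ≡ 0 → f ≡ 0
f²+f²≡0⇒f≡0 zero _ = refl

-- Two digits below `d` add without carry in base `d + d`, so each digit of `w` is the midpoint of
-- those of `u` and `v`. The excess of `s + s′` over `s″ + s″` starts nonnegative and grows by 2f²
-- with each digit, yet vanishes at the top. The returned equation carries this back through the
-- induction and forces every f to be zero.
lift-midpoint : ∀ {d D} {s s′ s″} (u v w : Vec (Fin d) D) → s″ + s″ ≤ s + s′ →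
  lift s u + lift s′ v ≡ lift s″ w + lift s″ w → u ≡ v × u ≡ w × s + s′ ≡ s″ + s″
lift-midpoint [] [] [] _ eq = refl , refl , eq
lift-midpoint {d} {s = s} {s′} {s″} (x ∷ u) (y ∷ v) (w ∷ t) s≤ eq
  with digit (U + V) (T + T) (+-mono-< (toℕ<n x) (toℕ<n y)) (+-mono-< (toℕ<n w) (toℕ<n w))
             (trans (i (toℕ x) (toℕ y) U V (d + d)) (trans eq (sym (i (toℕ w) (toℕ w) T T (d + d)))))
  where
  U V T : ℕ
  U = lift (s  + toℕ x * toℕ x) u
  V = lift (s′ + toℕ y * toℕ y) v
  T = lift (s″ + toℕ w * toℕ w) t
  i : ∀ x y U V B → x + y + (U + V) * B ≡ x + U * B + (y + V * B)
  i = solve-∀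
... | eq₀ , eq₁ with midpoint-squares (toℕ x) (toℕ y) (toℕ w) eq₀
...   | f , sq , f≡0⇒ with lift-midpoint u v t s≤′ eq₁
  where
  open ≤-Reasoning
  X = toℕ x * toℕ x
  Y = toℕ y * toℕ y
  W = toℕ w * toℕ w
  s≤′ : s″ + W + (s″ + W) ≤ s + X + (s′ + Y)
  s≤′ = begin
    s″ + W + (s″ + W)                   ≡⟨ +-interchange s″ W s″ W ⟩
    s″ + s″ + (W + W)                   ≤⟨ +-mono-≤ s≤ (m≤m+n (W + W) (f * f + f * f)) ⟩
    s + s′ + (W + W + (f * f + f * f))  ≡⟨ cong (s + s′ +_) sq ⟨
    s + s′ + (X + Y)                    ≡⟨ +-interchange s s′ X Y ⟩
    s + X + (s′ + Y)                    ∎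
...     | refl , refl , eq₂ = conclusion
  where
  X = toℕ x * toℕ x
  Y = toℕ y * toℕ y
  W = toℕ w * toℕ w
  defect : s + s′ + (f * f + f * f) ≡ s″ + s″
  defect = +-cancelʳ-≡ (W + W) _ _ (begin
    s + s′ + F + (W + W)    ≡⟨ +-rotate (s + s′) F (W + W) ⟩
    s + s′ + (W + W + F)    ≡⟨ cong (s + s′ +_) sq ⟨
    s + s′ + (X + Y)        ≡⟨ +-interchange s s′ X Y ⟩
    s + X + (s′ + Y)        ≡⟨ eq₂ ⟩
    s″ + W + (s″ + W)       ≡⟨ +-interchange s″ W s″ W ⟩
    s″ + s″ + (W + W)       ∎)
    where
    open ≡-Reasoning
    F = f * f + f * f
    +-rotate : ∀ a b c → a + b + c ≡ a + (c + b)
    +-rotate = solve-∀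
  f≡0 : f ≡ 0
  f≡0 = f²+f²≡0⇒f≡0 f (n≤0⇒n≡0 (+-cancelˡ-≤ (s + s′) _ _
    (≤-trans (≤-reflexive defect) (≤-trans s≤ (≤-reflexive (sym (+-identityʳ _)))))))
  conclusion : x ∷ u ≡ y ∷ u × x ∷ u ≡ w ∷ u × s + s′ ≡ s″ + s″
  conclusion with f≡0 | f≡0⇒ f≡0
  ... | refl | x≡y , x≡w = cong (_∷ u) (toℕ-injective x≡y) , cong (_∷ u) (toℕ-injective x≡w) ,
    trans (sym (+-identityʳ _)) defect

-- Each digit adds at most `d * d` to the top, which ends at most `s + D * (d * d)`, above `D`
-- digits in base `d + d`.
lift-< : ∀ {d D} s (v : Vec (Fin d) D) → lift s v < (s + D * (d * d) + 1) * (d + d) ^ D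
lift-< {d} s [] = ≤-reflexive (i s)
  where
  i : ∀ s → suc s ≡ (s + 0 + 1) * 1
  i = solve-∀
lift-< {d} {suc D} s (x ∷ v) = begin-strict
  toℕ x + L * B                             <⟨ +-monoˡ-< (L * B) (<-≤-trans (toℕ<n x) (m≤m+n d d)) ⟩
  suc L * B                                 ≤⟨ *-monoˡ-≤ B (lift-< (s + X) v) ⟩
  (s + X + D * (d * d) + 1) * B ^ D * B     ≤⟨ *-monoˡ-≤ B (*-monoˡ-≤ (B ^ D) (+-monoˡ-≤ 1 (+-monoˡ-≤ (D * (d * d))
                                                 (+-monoʳ-≤ s (*-mono-≤ x≤d x≤d))))) ⟩
  (s + d * d + D * (d * d) + 1) * B ^ D * B ≡⟨ i s (d * d) D (B ^ D) B ⟩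
  (s + suc D * (d * d) + 1) * B ^ suc D     ∎
  where
  open ≤-Reasoning
  B = d + d
  X = toℕ x * toℕ x
  L = lift (s + X) v
  x≤d = <⇒≤ (toℕ<n x)
  i : ∀ s e D P B → (s + e + D * e + 1) * P * B ≡ (s + (e + D * e) + 1) * (B * P)
  i = solve-∀

behrend : ∀ {d} D → Fin (d ^ D) → ℕ
behrend {d} D i = lift 0 (decode {D} {d} i)

behrend-progressionFree : ∀ {d} D → ProgressionFree (behrend {d} D)
behrend-progressionFree {d} D {i} {j} {k} eq
  with lift-midpoint (decode {D} {d} i) (decode j) (decode k) z≤n eq
... | i≡j , i≡k , _ = decode-injective {D} {d} i≡j , decode-injective {D} {d} i≡k

-- Choice of side and dimension

*-^-distrib : ∀ x y k → (x * y) ^ k ≡ x ^ k * y ^ k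
*-^-distrib x y zero    = refl
*-^-distrib x y (suc k) = trans (cong (x * y *_) (*-^-distrib x y k)) (*-interchange x y (x ^ k) (y ^ k))

double-^ : ∀ d k → (d + d) ^ k ≡ 2 ^ k * d ^ k
double-^ d k = trans (cong (λ e → (d + e) ^ k) (sym (+-identityʳ d))) (*-^-distrib 2 d k)

lastBelow : (f : ℕ → ℕ) → ∀ k {d n} → f d ≤ n → n < f (k + d) →
            ∃ λ e → d ≤ e × f e ≤ n × n < f (suc e)
lastBelow f zero    fd≤n n<fd = contradiction n<fd (≤⇒≯ fd≤n)
lastBelow f (suc k) {d} {n} fd≤n n< with n <? f (suc d)
... | yes n<f = d , ≤-refl , fd≤n , n<f
... | no  n≮f with lastBelow f k (≮⇒≥ n≮f) (subst (λ e → n < f e) (sym (+-suc k d)) n<)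
...   | e , d<e , rest = e , <⇒≤ d<e , rest

-- The constant combines `D * (d * d) + 1 ≤ suc D * (d * d)`, the `2 ^ D` from base `d + d`, and the
-- doubling that `ruzsaSzemerédi` asks for.
behrend-< : ∀ {d} .{{_ : NonZero d}} D (i : Fin (d ^ D)) →
            behrend {d} D i + behrend {d} D i < suc D * 2 ^ suc D * d ^ (2 + D)
behrend-< {d} D i = begin-strict
  behrend {d} D i + behrend {d} D i         <⟨ +-mono-< a< a< ⟩
  X + X                                     ≡⟨ cong (λ P → (D * (d * d) + 1) * P + (D * (d * d) + 1) * P) (double-^ d D) ⟩
  Y + Y                                     ≤⟨ +-mono-≤ Y≤ Y≤ ⟩
  suc D * (d * d) * (2 ^ D * d ^ D) + suc D * (d * d) * (2 ^ D * d ^ D)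
                                            ≡⟨ j D d (2 ^ D) (d ^ D) ⟩
  suc D * 2 ^ suc D * d ^ (2 + D)           ∎
  where
  open ≤-Reasoning
  X = (D * (d * d) + 1) * (d + d) ^ D
  Y = (D * (d * d) + 1) * (2 ^ D * d ^ D)
  a< : behrend {d} D i < X
  a< = lift-< 0 (decode {D} {d} i)
  0<d : 0 < d
  0<d = >-nonZero⁻¹ d
  Y≤ : Y ≤ suc D * (d * d) * (2 ^ D * d ^ D)
  Y≤ = *-monoˡ-≤ (2 ^ D * d ^ D) (≤-trans (+-monoʳ-≤ (D * (d * d)) (*-mono-≤ 0<d 0<d))
                                  (≤-reflexive (+-comm (D * (d * d)) (d * d))))
  j : ∀ D d P Q → suc D * (d * d) * (P * Q) + suc D * (d * d) * (P * Q) ≡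
                  suc D * (2 * P) * (d * (d * Q))
  j = solve-∀

x≤x^k : ∀ x k .{{_ : NonZero x}} .{{_ : NonZero k}} → x ≤ x ^ k
x≤x^k x (suc k) = m≤m*n x (x ^ k) {{m^n≢0 x k}}

-- Let D be `q + q`. Since `suc d ≤ d + d`, `n` is below `C′ * (d * d)` times `d ^ D`. In the q-th
-- power of the first factor, `C′ ^ q` is at most `d` and `(d * d) ^ q` is exactly `d ^ D`, by the
-- choice of D; so this power is at most `n`, hence at most `n ^ p`.
power-gap : ∀ C p q d n .{{_ : NonZero C}} .{{_ : NonZero p}} .{{_ : NonZero q}} .{{_ : NonZero d}} →
            (C * 2 ^ (2 + (q + q))) ^ q ≤ d →
            C * d ^ (2 + (q + q)) ≤ n → n < C * suc d ^ (2 + (q + q)) →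
            n ^ q < n ^ p * (d ^ (q + q)) ^ q
power-gap C p q d n ≤d ≤n n< = begin-strict
  n ^ q                                 <⟨ ^-monoˡ-< q n< ⟩
  (C * suc d ^ (2 + D)) ^ q             ≤⟨ ^-monoˡ-≤ q (*-monoʳ-≤ C (^-monoˡ-≤ (2 + D)
                                             (+-monoˡ-≤ d (>-nonZero⁻¹ d)))) ⟩
  (C * (d + d) ^ (2 + D)) ^ q           ≡⟨ cong (λ P → (C * P) ^ q) (double-^ d (2 + D)) ⟩
  (C * (2 ^ (2 + D) * d ^ (2 + D))) ^ q ≡⟨ cong (_^ q) (i C (2 ^ (2 + D)) d (d ^ D)) ⟩
  (C′ * (d * d) * d ^ D) ^ q            ≡⟨ *-^-distrib (C′ * (d * d)) (d ^ D) q ⟩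
  (C′ * (d * d)) ^ q * (d ^ D) ^ q      ≡⟨ cong (_* (d ^ D) ^ q) (*-^-distrib C′ (d * d) q) ⟩
  C′ ^ q * (d * d) ^ q * (d ^ D) ^ q    ≤⟨ *-monoˡ-≤ ((d ^ D) ^ q) ≤n^p ⟩
  n ^ p * (d ^ D) ^ q                   ∎
  where
  open ≤-Reasoning
  D C′ : ℕ
  D  = q + q
  C′ = C * 2 ^ (2 + D)
  i : ∀ C P d Q → C * (P * (d * (d * Q))) ≡ C * P * (d * d) * Q
  i = solve-∀
  d^≤n : d ^ (2 + D) ≤ n
  d^≤n = ≤-trans (m≤n*m (d ^ (2 + D)) C) ≤n
  n≢0 : NonZero n
  n≢0 = >-nonZero (≤-trans (m^n>0 d (2 + D)) d^≤n)
  ≤n^p : C′ ^ q * (d * d) ^ q ≤ n ^ p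
  ≤n^p = begin
    C′ ^ q * (d * d) ^ q     ≡⟨ cong (C′ ^ q *_) (*-^-distrib d d q) ⟩
    C′ ^ q * (d ^ q * d ^ q) ≡⟨ cong (C′ ^ q *_) (^-distribˡ-+-* d q q) ⟨
    C′ ^ q * d ^ D           ≤⟨ *-monoˡ-≤ (d ^ D) ≤d ⟩
    d ^ suc D                ≤⟨ ^-monoʳ-≤ d (n≤1+n (suc D)) ⟩
    d ^ (2 + D)              ≤⟨ d^≤n ⟩
    n                        ≤⟨ x≤x^k n p {{n≢0}} ⟩
    n ^ p                    ∎

-- The threshold `f M` lets the search for `d` start at `M`, the least side that `power-gap` admits.
fitting-side : ∀ C p q .{{_ : NonZero C}} .{{_ : NonZero p}} .{{_ : NonZero q}} →
  ∃ λ N → ∀ n → N ≤ n → ∃ λ d →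
  NonZero d × C * d ^ (2 + (q + q)) ≤ n × n ^ q < n ^ p * (d ^ (q + q)) ^ q
fitting-side C p q = f M , fit
  where
  D M : ℕ
  D = q + q
  M = (C * 2 ^ (2 + D)) ^ q

  f : ℕ → ℕ
  f d = C * d ^ (2 + D)

  0<M : 0 < M
  0<M = m^n>0 (C * 2 ^ (2 + D)) {{m*n≢0 C (2 ^ (2 + D)) {{it}} {{m^n≢0 2 (2 + D)}}}} q

  d≤f[d] : ∀ d .{{_ : NonZero d}} → d ≤ f d
  d≤f[d] d = ≤-trans (x≤x^k d (2 + D)) (m≤n*m (d ^ (2 + D)) C)

  fit : ∀ n → f M ≤ n → ∃ λ d → NonZero d × f d ≤ n × n ^ q < n ^ p * (d ^ D) ^ q
  -- `suc n` search steps suffice: `f` is at least its argument, so it exceeds `n` at `suc n + M`.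
  fit n fM≤n with lastBelow f (suc n) fM≤n (≤-trans (m≤m+n (suc n) M) (d≤f[d] (suc n + M)))
  ... | d , M≤d , fd≤n , n<f = d , d≢0 , fd≤n , power-gap C p q d n {{it}} {{it}} {{it}} {{d≢0}} M≤d fd≤n n<f
    where
    d≢0 : NonZero d
    d≢0 = >-nonZero (≤-trans 0<M M≤d)

-- In dimension D the set has d ^ D elements below a multiple of d ^ (2 + D);
-- dimension 2q makes the loss d ^ 2 smaller than the factor n ^ (p / q).
behrend-dense : ∀ p q .{{_ : NonZero p}} .{{_ : NonZero q}} → ∃ λ N → ∀ n → N ≤ n →
  ∃₂ λ K (a : Fin K → ℕ) → ProgressionFree a × (∀ i → a i + a i < n) × n ^ q < n ^ p * K ^ q
behrend-dense p q =
  let D = q + q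
      (N , fit) = fitting-side (suc D * 2 ^ suc D) p q
                    {{m*n≢0 (suc D) (2 ^ suc D) {{nonZero}} {{m^n≢0 2 (suc D)}}}}
  in N , λ n N≤n →
    let (d , d≢0 , ≤n , large) = fit n N≤n
    in d ^ D , behrend D , behrend-progressionFree D ,
       (λ i → <-≤-trans (behrend-< {{d≢0}} D i) ≤n) , large

-- Passing to the asymptotic comparison

module _ {n p q K f g : ℕ} (n^q< : n ^ q < n ^ p * K ^ q) (Kg≤f : K * g ≤ f) where

  private
    ≤n^pf^q : n ^ p * K ^ q * g ^ q ≤ n ^ p * f ^ q
    ≤n^pf^q = begin
      n ^ p * K ^ q * g ^ q   ≡⟨ *-assoc (n ^ p) (K ^ q) (g ^ q) ⟩
      n ^ p * (K ^ q * g ^ q) ≡⟨ cong (n ^ p *_) (*-^-distrib K g q) ⟨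
      n ^ p * (K * g) ^ q     ≤⟨ *-monoʳ-≤ (n ^ p) (^-monoˡ-≤ q Kg≤f) ⟩
      n ^ p * f ^ q           ∎
      where open ≤-Reasoning

  factor-≤ : n ^ q * g ^ q ≤ n ^ p * f ^ q
  factor-≤ = ≤-trans (*-monoˡ-≤ (g ^ q) (<⇒≤ n^q<)) ≤n^pf^q

  factor-< : 0 < g → n ^ q * g ^ q < n ^ p * f ^ q
  factor-< 0<g = <-≤-trans (*-monoˡ-< (g ^ q) {{m^n≢0 g q {{>-nonZero 0<g}}}} n^q<) ≤n^pf^q

module _ {f g : ℕ → ℕ}
         (K*g≤f : ∀ {K n} → .{{NonZero n}} → InducedMatchings K n → K * g n ≤ f n) where

  private
    gap : ∀ p q → 0 < p → 0 < q → ∃ λ N → ∀ n → N < n →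
          ∃ λ K → n ^ q < n ^ p * K ^ q × K * g n ≤ f n
    gap p q 0<p 0<q =
      let (N , dense) = behrend-dense p q {{>-nonZero 0<p}} {{>-nonZero 0<q}}
      -- `N < n` instead of `N ≤ n` makes `n` nonzero, as arithmetic modulo `n` requires.
      in N , λ n N<n →
        let (K , a , free , 2a<n , n^q<) = dense n (<⇒≤ N<n)
            n≢0 = >-nonZero (m<n⇒0<n N<n)
        in K , n^q< , K*g≤f {{n≢0}} (ruzsaSzemerédi {{n≢0}} a free 2a<n)

  matchings⇒≥ : f ≥n^[1-o1]· g
  matchings⇒≥ p q 0<p 0<q =
    let (N , bound) = gap p q 0<p 0<q
    in suc N , λ n N<n →
      let (_ , n^q< , Kg≤f) = bound n N<n
      in factor-≤ {n} {p} {q} n^q< Kg≤f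

  matchings⇒> : (∀ n → .{{NonZero n}} → 0 < g n) → f >n^[1-o1]· g
  matchings⇒> 0<g p q 0<p 0<q =
    let (N , bound) = gap p q 0<p 0<q
    in suc N , λ n N<n →
      let (_ , n^q< , Kg≤f) = bound n N<n
      in factor-< {n} {p} {q} n^q< Kg≤f (0<g n {{>-nonZero (m<n⇒0<n N<n)}})

theorem1 : ∀ (m : ℕ) (s : Vec ℕ m) (b c t : ℕ) →
    All (0 <_) (s ∷ʳ b ∷ʳ c ∷ʳ t) →
    ((λ n → z (3 + m) n (s ∷ʳ b ∷ʳ c ∷ʳ t))
    ≥n^[1-o1]· (λ n → z (2 + m) n (s ∷ʳ b * c ∷ʳ t)))
    × (Any (1 <_) (s ∷ʳ b ∷ʳ c ∷ʳ t) →
    (λ n → z (3 + m) n (s ∷ʳ b ∷ʳ c ∷ʳ t))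
    >n^[1-o1]· (λ n → z (2 + m) n (s ∷ʳ b * c ∷ʳ t)))
theorem1 m s b c t pos =
  matchings⇒≥ {f} {g} K*g≤f ,
  -- If all sizes were 1, a copy would be a single edge, both numbers would be 0 and the strict
  -- comparison would fail; a size above 1 makes `g n` positive for nonzero `n`.
  λ 1< → matchings⇒> {f} {g} K*g≤f λ n →
    z-positive {2 + m} {n} {{it}} {s ∷ʳ b * c ∷ʳ t} (All-contract s pos) (Any-contract s pos 1<)
  where
  f g : ℕ → ℕ
  f n = z (3 + m) n (s ∷ʳ b ∷ʳ c ∷ʳ t)
  g n = z (2 + m) n (s ∷ʳ b * c ∷ʳ t)

  K*g≤f : ∀ {K n} → .{{NonZero n}} → InducedMatchings K n → K * g n ≤ f n
  K*g≤f {K} {n} M = z-blowup {K} {n} {m} M s {b} {c} {t} pos
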